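{- Let $k \geq 3$ and let $G$ be a diregular $(2,k,+3)$-digraph. Then $G$ contains a pair of distinct vertices $u,v$ with exactly one common out-neighbour, i.e. $|N^+(u)\cap N^+(v)|=1$.
   Context: A digraph $G$ is $k$-geodetic if for every ordered pair of (not necessarily distinct) vertices $x,y$ there is at most one directed path from $x$ to $y$ of length at most $k$ (the trivial path of length $0$ counts, so there are no directed cycles of length at most $k$). $M(d,k)=1+d+\dots+d^k$. A $(d,k,+\epsilon)$-digraph is a $k$-geodetic digraph with minimum out-degree $d$ and order $M(d,k)+\epsilon$; it is diregular if every vertex has in-degree and out-degree exactly $d$. $N^+(x)$ denotes the set of out-neighbours of $x$. -}

module Defs where

open import Data.Nat using (ℕ; zero; suc; _+_; _^_; _≤_)
open import Data.Fin using (Fin)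
open import Data.Fin.Subset using (Subset; _∈_; ∣_∣)
open import Data.List using (List; []; _∷_; map; sum; upTo)
open import Data.List.Relation.Unary.Unique.Propositional using (Unique)
open import Data.Product using (_×_; ∃)
open import Data.Vec using (lookup; tabulate)
open import Relation.Binary.PropositionalEquality using (_≡_)

-- The arcs form a set of ordered pairs, so there are no parallel arcs.  Loops
-- are not excluded here, but a loop is a path of length 1 from a vertex to
-- itself, so no k-geodetic digraph with k ≥ 1 has one.
record Digraph (n : ℕ) : Set where
  field
    N⁺ : Fin n → Subset n

  N⁻ : Fin n → Subset n
  N⁻ y = tabulate λ x → lookup (N⁺ x) y

  outdegree : Fin n → ℕ
  outdegree x = ∣ N⁺ x ∣

  indegree : Fin n → ℕ
  indegree x = ∣ N⁻ x ∣

  infixr 5 _∷_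

  data Walk : Fin n → Fin n → Set where
    []  : ∀ {x} → Walk x x
    _∷_ : ∀ {x y z} → y ∈ N⁺ x → Walk y z → Walk x z

  length : ∀ {x y} → Walk x y → ℕ
  length []      = zero
  length (_ ∷ w) = suc (length w)

  -- For a walk x₀ → x₁ → ⋯ → xₗ these are [x₀, …, xₗ₋₁] and [x₁, …, xₗ].
  tails : ∀ {x y} → Walk x y → List (Fin n)
  tails []              = []
  tails (_∷_ {x = x} _ w) = x ∷ tails w

  heads : ∀ {x y} → Walk x y → List (Fin n)
  heads []              = []
  heads (_∷_ {y = y} _ w) = y ∷ heads w

  -- No vertex is repeated, except that x₀ = xₗ is allowed, so that a directed
  -- cycle through x is a path from x to x.
  IsPath : ∀ {x y} → Walk x y → Set
  IsPath w = Unique (tails w) × Unique (heads w)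

  -- Equality of walks amounts to equality of vertex sequences, since
  -- y ∈ N⁺ x has at most one proof.
  Geodetic : ℕ → Set
  Geodetic k = ∀ x y (p q : Walk x y) → IsPath p → IsPath q →
               length p ≤ k → length q ≤ k → p ≡ q

  MinOutdegree : ℕ → Set
  MinOutdegree d = (∀ x → d ≤ outdegree x) × ∃ λ x → outdegree x ≡ d

  Diregular : ℕ → Set
  Diregular d = ∀ x → indegree x ≡ d × outdegree x ≡ d

M : ℕ → ℕ → ℕ
M d k = sum (map (d ^_) (upTo (suc k)))

-- (d,k,+ε)-digraphs
record IsExcessDigraph (d k ε : ℕ) {n : ℕ} (G : Digraph n) : Set where
  open Digraph G
  field
    geodetic     : Geodetic k
    minOutdegree : MinOutdegree d
    order        : n ≡ M d k + ε

{-# OPTIONS --safe #-}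
-- Suppose that no two distinct vertices have exactly one common out-neighbour.
-- Then vertices with a common out-neighbour have the same out-neighbourhood, and
-- since in-degrees are 2, every vertex c has a unique twin c′ ≢ c with N⁺ c = N⁺ c′.
-- Let c* be the other out-neighbour of an in-neighbour of c, and c′* likewise for c′.
-- Short closed walks do not exist, so c does not reach c*, c′, c′* within k steps; as
-- c reaches M(2,k) vertices and n = M(2,k) + 3, it reaches every other vertex.
-- Now let a → b₁, b₂ with b₁ ≢ b₂, b₁ → c₁, c₂ with c₁ ≢ c₂, and b₂ → d.  Each cᵢ
-- reaches d, and the last step cannot start at b₂, because replacing b₂ by b₁ would
-- close up a walk b₁ → cᵢ → ⋯ → b₂.  So it starts at the twin of b₂, to which b₁ then
-- has two walks of length at most k, through c₁ and through c₂.
module Submission where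

open import Defs
open import Data.Empty using (⊥; ⊥-elim)
open import Data.Fin using (Fin; zero; suc)
open import Data.Fin.Properties using (_≟_; any?; injective⇒≤)
open import Data.Fin.Subset using (Subset; inside; outside; _∈_; _∉_; _⊆_; _∩_; ∣_∣; ⁅_⁆)
open import Data.Fin.Subset.Properties using (_∈?_; x∈⁅x⁆; x∈⁅y⁆⇒x≡y; ∣⁅x⁆∣≡1; ⊆-antisym; x∈p∩q⁺; x∈p∩q⁻)
open import Data.List as List using (List; []; _∷_; _++_; applyUpTo)
open import Data.List.Membership.Propositional using () renaming (_∈_ to _∈ˡ_; _∉_ to _∉ˡ_)
open import Data.List.Membership.Propositional.Properties using (∈-lookup; ∈-++⁻)
open import Data.List.Properties using (length-++; map-applyUpTo; map-upTo; ∷-injectiveˡ)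
open import Data.List.Relation.Unary.All as All using ()
open import Data.List.Relation.Unary.All.Properties using (¬Any⇒All¬)
open import Data.List.Relation.Unary.AllPairs using ([]; _∷_)
open import Data.List.Relation.Unary.Any using (here; there)
open import Data.List.Relation.Unary.Unique.Propositional using (Unique)
open import Data.List.Relation.Unary.Unique.Propositional.Properties using (++⁺)
open import Data.Nat as ℕ using (ℕ; zero; suc; _+_; _*_; _^_; _≤_; _<_; z≤n; s≤s)
open import Data.Nat.ListAction using (sum)
open import Data.Nat.Properties using (≤-refl; ≤-reflexive; ≤-trans; <⇒≤; m≤n⇒m≤1+n; 1+n≰n; +-identityʳ; +-comm; *-zeroʳ; *-distribˡ-+; suc-injective)
open import Data.Product using (_×_; _,_; proj₁; proj₂; ∃; ∃₂)
open import Data.Sum as Sum using (_⊎_; inj₁; inj₂)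
open import Data.Vec using ([]; _∷_; here; there)
open import Data.Vec.Properties using (lookup∘tabulate; []=⇒lookup; lookup⇒[]=)
open import Function using (_∘_)
open import Relation.Binary.PropositionalEquality using (_≡_; _≢_; refl; sym; trans; cong; cong₂; subst)
open import Relation.Nullary using (yes; no; ¬?; contradiction; _×-dec_)

import Data.List.Membership.DecPropositional as DecMembership

-- Subsets with at most two elements

∣p∣≡0⇒x∉p : ∀ {n} {p : Subset n} {x} → ∣ p ∣ ≡ 0 → x ∉ p
∣p∣≡0⇒x∉p {p = outside ∷ p} eq (there x∈p) = ∣p∣≡0⇒x∉p eq x∈p

∣p∣≡1⇒singleton : ∀ {n} (p : Subset n) → ∣ p ∣ ≡ 1 → ∃ λ x → x ∈ p × (∀ {z} → z ∈ p → z ≡ x)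
∣p∣≡1⇒singleton (inside ∷ p) eq = zero , here , λ where
  here        → refl
  (there z∈p) → contradiction z∈p (∣p∣≡0⇒x∉p (suc-injective eq))
∣p∣≡1⇒singleton (outside ∷ p) eq with ∣p∣≡1⇒singleton p eq
... | x , x∈p , only = suc x , there x∈p , λ where (there z∈p) → cong suc (only z∈p)

∣p∣≡2⇒inhabited : ∀ {n} (p : Subset n) → ∣ p ∣ ≡ 2 → ∃ (_∈ p)
∣p∣≡2⇒inhabited (inside  ∷ p) eq = zero , here
∣p∣≡2⇒inhabited (outside ∷ p) eq with ∣p∣≡2⇒inhabited p eq
... | x , x∈p = suc x , there x∈p

∣p∣≡2⇒other : ∀ {n} {p : Subset n} {x} → ∣ p ∣ ≡ 2 → x ∈ p →
              ∃ λ y → y ≢ x × y ∈ p × (∀ {z} → z ∈ p → z ≡ x ⊎ z ≡ y)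
∣p∣≡2⇒other {p = inside ∷ p} eq here with ∣p∣≡1⇒singleton p (suc-injective eq)
... | y , y∈p , only = suc y , (λ ()) , there y∈p , λ where
  here        → inj₁ refl
  (there z∈p) → inj₂ (cong suc (only z∈p))
∣p∣≡2⇒other {p = inside ∷ p} eq (there x∈p) with ∣p∣≡1⇒singleton p (suc-injective eq)
... | y , y∈p , only = zero , (λ ()) , here , λ where
  here        → inj₂ refl
  (there z∈p) → inj₁ (cong suc (trans (only z∈p) (sym (only x∈p))))
∣p∣≡2⇒other {p = outside ∷ p} eq (there x∈p) with ∣p∣≡2⇒other eq x∈p
... | y , y≢x , y∈p , only = suc y , (λ { refl → y≢x refl }) , there y∈p , λ where
  (there z∈p) → Sum.map (cong suc) (cong suc) (only z∈p)

-- If some `y` in `p` missed `q`, then `x` would be the other element of `p`, and `p ∩ q` would be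
-- exactly `⁅ x ⁆`.
∣p∩q∣≢1⇒p⊆q : ∀ {n} {p q : Subset n} {x} → ∣ p ∣ ≡ 2 → ∣ p ∩ q ∣ ≢ 1 → x ∈ p → x ∈ q → p ⊆ q
∣p∩q∣≢1⇒p⊆q {p = p} {q} {x} ∣p∣≡2 ∣p∩q∣≢1 x∈p x∈q {y} y∈p with y ∈? q
... | yes y∈q = y∈q
... | no  y∉q = contradiction (trans (cong ∣_∣ p∩q≡⁅x⁆) (∣⁅x⁆∣≡1 x)) ∣p∩q∣≢1
  where
  p∩q⊆⁅x⁆ : p ∩ q ⊆ ⁅ x ⁆
  p∩q⊆⁅x⁆ {z} z∈p∩q with x∈p∩q⁻ p q z∈p∩q | ∣p∣≡2⇒other ∣p∣≡2 y∈p
  ... | z∈p , z∈q | w , _ , _ , only with only x∈p | only z∈p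
  ...   | inj₁ refl | _         = contradiction x∈q y∉q
  ...   | inj₂ refl | inj₁ refl = contradiction z∈q y∉q
  ...   | inj₂ refl | inj₂ refl = x∈⁅x⁆ x

  p∩q≡⁅x⁆ : p ∩ q ≡ ⁅ x ⁆
  p∩q≡⁅x⁆ = ⊆-antisym p∩q⊆⁅x⁆ λ z∈⁅x⁆ →
    subst (_∈ p ∩ q) (sym (x∈⁅y⁆⇒x≡y x z∈⁅x⁆)) (x∈p∩q⁺ (x∈p , x∈q))

-- Duplicate-free lists and the recursion for `M`

lookup-injective : ∀ {a} {A : Set a} {xs : List A} → Unique xs →
                   ∀ {i j} → List.lookup xs i ≡ List.lookup xs j → i ≡ j
lookup-injective (x∉xs ∷ xs!) {zero}  {zero}  eq = refl
lookup-injective (x∉xs ∷ xs!) {zero}  {suc j} eq = contradiction eq (All.lookup x∉xs (∈-lookup j))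
lookup-injective (x∉xs ∷ xs!) {suc i} {zero}  eq = contradiction (sym eq) (All.lookup x∉xs (∈-lookup i))
lookup-injective (x∉xs ∷ xs!) {suc i} {suc j} eq = cong suc (lookup-injective xs! eq)

∉⇒∷-unique : ∀ {a} {A : Set a} {x : A} {xs} → x ∉ˡ xs → Unique xs → Unique (x ∷ xs)
∉⇒∷-unique x∉xs xs! = ¬Any⇒All¬ _ x∉xs ∷ xs!

-- Prepending a missing `y` would give more than `n` distinct elements of `Fin n`.
unique-complete : ∀ {n} {xs : List (Fin n)} → Unique xs → n ≤ List.length xs → ∀ y → y ∈ˡ xs
unique-complete {xs = xs} xs! n≤∣xs∣ y with DecMembership._∈?_ _≟_ y xs
... | yes y∈xs = y∈xs
... | no  y∉xs = contradiction (≤-trans (injective⇒≤ (lookup-injective (∉⇒∷-unique y∉xs xs!))) n≤∣xs∣) 1+n≰n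

sum-applyUpTo-* : ∀ c (f : ℕ → ℕ) m → sum (applyUpTo (λ i → c * f i) m) ≡ c * sum (applyUpTo f m)
sum-applyUpTo-* c f zero    = sym (*-zeroʳ c)
sum-applyUpTo-* c f (suc m) = trans (cong (c * f 0 +_) (sum-applyUpTo-* c (f ∘ suc) m))
                                    (sym (*-distribˡ-+ c (f 0) _))

M-suc : ∀ d k → M d (suc k) ≡ suc (d * M d k)
M-suc d k = cong suc (trans (cong sum (map-applyUpTo suc (d ^_) (suc k)))
  (trans (sum-applyUpTo-* d (d ^_) (suc k)) (cong (λ xs → d * sum xs) (sym (map-upTo (d ^_) (suc k))))))

-- From paths to walks in a geodetic digraph

module Walks {n} (G : Digraph n) where
  open Digraph G

  ∈N⁺⇒∈N⁻ : ∀ {x y} → y ∈ N⁺ x → x ∈ N⁻ y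
  ∈N⁺⇒∈N⁻ {x} {y} y∈ = lookup⇒[]= x (N⁻ y) (trans (lookup∘tabulate _ x) ([]=⇒lookup y∈))

  ∈N⁻⇒∈N⁺ : ∀ {x y} → x ∈ N⁻ y → y ∈ N⁺ x
  ∈N⁻⇒∈N⁺ {x} {y} x∈ = lookup⇒[]= y (N⁺ x) (trans (sym (lookup∘tabulate _ x)) ([]=⇒lookup x∈))

  unsnoc : ∀ {x y z} (e : y ∈ N⁺ x) (w : Walk y z) →
           ∃ λ u → z ∈ N⁺ u × ∃ λ (w′ : Walk x u) → length w′ ≡ length w
  unsnoc e []      = _ , e , [] , refl
  unsnoc e (f ∷ w) with unsnoc f w
  ... | u , g , w′ , eq = u , g , e ∷ w′ , cong suc eq

  ∈tails⇒prefix : ∀ {x y z} (w : Walk x y) → z ∈ˡ tails w →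
                  ∃ λ (w′ : Walk x z) → length w′ < length w
  ∈tails⇒prefix (e ∷ w) (here refl) = [] , s≤s z≤n
  ∈tails⇒prefix (e ∷ w) (there z∈)  with ∈tails⇒prefix w z∈
  ... | w′ , lt = e ∷ w′ , s≤s lt

  ∈heads⇒prefix : ∀ {x y z} (w : Walk x y) → z ∈ˡ heads w →
                  ∃₂ λ u (e : u ∈ N⁺ x) → ∃ λ (w′ : Walk u z) → length w′ < length w
  ∈heads⇒prefix (e ∷ w) (here refl) = _ , e , [] , s≤s z≤n
  ∈heads⇒prefix (e ∷ w) (there z∈)  with ∈heads⇒prefix w z∈
  ... | _ , f , w′ , lt = _ , e , f ∷ w′ , s≤s lt

  -- Splitting off the first arc excludes the trivial walk; the closed walk `e ∷ w` then has length
  -- at most `m`.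
  NoClosedWalk : ℕ → Set
  NoClosedWalk m = ∀ {x y} (e : y ∈ N⁺ x) (w : Walk y x) → length w < m → ⊥

  -- A repetition in `tails` or `heads` cuts out a closed walk that misses at least one arc of `w`,
  -- hence the bound `suc m`.
  shortWalk-isPath : ∀ {m} → NoClosedWalk m → ∀ {x y} (w : Walk x y) → length w ≤ suc m → IsPath w
  shortWalk-isPath {m} acyclic w ≤1+m = tails! w ≤1+m , heads! w ≤1+m
    where
    tails! : ∀ {x y} (w : Walk x y) → length w ≤ suc m → Unique (tails w)
    tails! []      _         = []
    tails! (e ∷ w) (s≤s len) = ∉⇒∷-unique
      (λ x∈ → let w′ , lt = ∈tails⇒prefix w x∈ in acyclic e w′ (≤-trans lt len))
      (tails! w (m≤n⇒m≤1+n len))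

    heads! : ∀ {x y} (w : Walk x y) → length w ≤ suc m → Unique (heads w)
    heads! []      _         = []
    heads! (e ∷ w) (s≤s len) = ∉⇒∷-unique
      (λ y∈ → let _ , f , w′ , lt = ∈heads⇒prefix w y∈ in acyclic f w′ (≤-trans lt len))
      (heads! w (m≤n⇒m≤1+n len))

  -- `Geodetic` compares paths only, hence the induction: without closed walks of length at most
  -- `m`, one of length `suc m` is a path, and it competes with the trivial path.
  geodetic⇒noClosedWalk : ∀ {k} → Geodetic k → ∀ m → m ≤ k → NoClosedWalk m
  geodetic⇒noClosedWalk geo (suc m) m<k e w lt
    with geo _ _ (e ∷ w) [] (shortWalk-isPath (geodetic⇒noClosedWalk geo m (<⇒≤ m<k)) (e ∷ w) lt)
             ([] , []) (≤-trans lt m<k) z≤n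
  ... | ()

  geodetic⇒unique-walk : ∀ {k} → Geodetic k → ∀ {x y} (p q : Walk x y) → length p ≤ k → length q ≤ k → p ≡ q
  geodetic⇒unique-walk {k} geo p q p≤k q≤k = geo _ _ p q (isPath p p≤k) (isPath q q≤k) p≤k q≤k
    where
    isPath : ∀ {x y} (w : Walk x y) → length w ≤ k → IsPath w
    isPath w w≤k = shortWalk-isPath (geodetic⇒noClosedWalk geo k ≤-refl) w (m≤n⇒m≤1+n w≤k)

-- Consequences of no two vertices having exactly one common out-neighbour

module NoSinglyShared {k n} (G : Digraph n) (3≤k : 3 ≤ k)
  (excess : IsExcessDigraph 2 k 3 G) (diregular : Digraph.Diregular G 2)
  (none : ∀ u v → u ≢ v → ∣ Digraph.N⁺ G u ∩ Digraph.N⁺ G v ∣ ≢ 1) where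

  open Digraph G
  open IsExcessDigraph excess
  open Walks G

  acyclic : NoClosedWalk k
  acyclic = geodetic⇒noClosedWalk geodetic k ≤-refl

  fork : ∀ {x y₁ y₂ z} → y₁ ∈ N⁺ x → y₂ ∈ N⁺ x → (w₁ : Walk y₁ z) (w₂ : Walk y₂ z) →
         length w₁ < k → length w₂ < k → y₁ ≡ y₂
  fork e₁ e₂ w₁ w₂ <k₁ <k₂ =
    ∷-injectiveˡ (cong heads (geodetic⇒unique-walk geodetic (e₁ ∷ w₁) (e₂ ∷ w₂) <k₁ <k₂))

  out : ∀ x → ∃ (_∈ N⁺ x)
  out x = ∣p∣≡2⇒inhabited (N⁺ x) (proj₂ (diregular x))

  inn : ∀ x → ∃ λ u → x ∈ N⁺ u
  inn x with ∣p∣≡2⇒inhabited (N⁻ x) (proj₁ (diregular x))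
  ... | u , u∈ = u , ∈N⁻⇒∈N⁺ u∈

  other-out : ∀ {x y} → y ∈ N⁺ x → ∃ λ y′ → y′ ≢ y × y′ ∈ N⁺ x
  other-out y∈ with ∣p∣≡2⇒other (proj₂ (diregular _)) y∈
  ... | y′ , y′≢y , y′∈ , _ = y′ , y′≢y , y′∈

  other-in : ∀ {x y} → y ∈ N⁺ x → ∃ λ x′ → x′ ≢ x × y ∈ N⁺ x′ × (∀ {u} → y ∈ N⁺ u → u ≡ x ⊎ u ≡ x′)
  other-in y∈ with ∣p∣≡2⇒other (proj₁ (diregular _)) (∈N⁺⇒∈N⁻ y∈)
  ... | x′ , x′≢x , x′∈ , only = x′ , x′≢x , ∈N⁻⇒∈N⁺ x′∈ , only ∘ ∈N⁺⇒∈N⁻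

  share : ∀ {u v x y} → x ∈ N⁺ u → x ∈ N⁺ v → y ∈ N⁺ u → y ∈ N⁺ v
  share {u} {v} x∈u x∈v y∈u with u ≟ v
  ... | yes refl = y∈u
  ... | no  u≢v  = ∣p∩q∣≢1⇒p⊆q (proj₂ (diregular u)) (none u v u≢v) x∈u x∈v y∈u

  -- Only the last arc changes: its tail shares the out-neighbour `z` with `p`, so it also has the
  -- out-neighbour `z′`. If `w` is trivial, that arc is `e` itself, so `y′` may differ from `y`.
  redirect : ∀ {p x y z z′} → z ∈ N⁺ p → z′ ∈ N⁺ p → y ∈ N⁺ x → (w : Walk y z) →
             ∃₂ λ y′ (e : y′ ∈ N⁺ x) → ∃ λ (w′ : Walk y′ z′) → length w′ ≡ length w
  redirect z∈ z′∈ e []      = _ , share z∈ e z′∈ , [] , refl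
  redirect z∈ z′∈ e (f ∷ w) with redirect z∈ z′∈ f w
  ... | _ , f′ , w′ , eq = _ , e , f′ ∷ w′ , cong suc eq

  -- The binary out-tree of a vertex

  out₁ out₂ : Fin n → Fin n
  out₁ x = proj₁ (out x)
  out₂ x = proj₁ (other-out (proj₂ (out x)))

  out₁∈ : ∀ x → out₁ x ∈ N⁺ x
  out₁∈ x = proj₂ (out x)

  out₂∈ : ∀ x → out₂ x ∈ N⁺ x
  out₂∈ x = proj₂ (proj₂ (other-out (out₁∈ x)))

  out₂≢out₁ : ∀ x → out₂ x ≢ out₁ x
  out₂≢out₁ x = proj₁ (proj₂ (other-out (out₁∈ x)))

  reach : ℕ → Fin n → List (Fin n)
  reach zero    x = x ∷ []
  reach (suc m) x = x ∷ reach m (out₁ x) ++ reach m (out₂ x)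

  length-reach : ∀ m x → List.length (reach m x) ≡ M 2 m
  length-reach zero    x = refl
  length-reach (suc m) x = trans
    (cong suc (trans (length-++ (reach m (out₁ x)))
      (cong₂ _+_ (length-reach m (out₁ x)) (trans (length-reach m (out₂ x)) (sym (+-identityʳ _))))))
    (sym (M-suc 2 m))

  reach⇒walk : ∀ m {x y} → y ∈ˡ reach m x → ∃ λ (w : Walk x y) → length w ≤ m
  reach⇒walk zero    (here refl) = [] , z≤n
  reach⇒walk (suc m) (here refl) = [] , z≤n
  reach⇒walk (suc m) {x} (there y∈) with ∈-++⁻ (reach m (out₁ x)) y∈
  ... | inj₁ y∈₁ = let w , len = reach⇒walk m y∈₁ in out₁∈ x ∷ w , s≤s len
  ... | inj₂ y∈₂ = let w , len = reach⇒walk m y∈₂ in out₂∈ x ∷ w , s≤s len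

  -- A vertex in both subtrees would contradict `fork`, and the root in a subtree would give a short
  -- closed walk.
  reach! : ∀ m x → m ≤ k → Unique (reach m x)
  reach! zero    x _   = ∉⇒∷-unique (λ ()) []
  reach! (suc m) x m<k = ∉⇒∷-unique (root∉ ∘ ∈-++⁻ (reach m (out₁ x)))
    (++⁺ (reach! m (out₁ x) m≤k) (reach! m (out₂ x) m≤k) λ (v∈₁ , v∈₂) →
      let w₁ , len₁ = reach⇒walk m v∈₁ ; w₂ , len₂ = reach⇒walk m v∈₂
      in out₂≢out₁ x (fork (out₂∈ x) (out₁∈ x) w₂ w₁ (≤-trans (s≤s len₂) m<k) (≤-trans (s≤s len₁) m<k)))
    where
    m≤k : m ≤ k
    m≤k = <⇒≤ m<k

    root∉ : x ∈ˡ reach m (out₁ x) ⊎ x ∈ˡ reach m (out₂ x) → ⊥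
    root∉ (inj₁ x∈) = let w , len = reach⇒walk m x∈ in acyclic (out₁∈ x) w (≤-trans (s≤s len) m<k)
    root∉ (inj₂ x∈) = let w , len = reach⇒walk m x∈ in acyclic (out₂∈ x) w (≤-trans (s≤s len) m<k)

  -- Vertices out of reach within `k` steps

  1<k : 1 < k
  1<k = ≤-trans (s≤s (s≤s z≤n)) 3≤k

  -- Redirecting the last arc from `c*` to `c` closes the walk.
  no-walk-to-sibling : ∀ {b c c*} → c ∈ N⁺ b → c* ∈ N⁺ b → c* ≢ c → (w : Walk c c*) → length w ≤ k → ⊥
  no-walk-to-sibling c∈ c*∈ c*≢c []      _   = c*≢c refl
  no-walk-to-sibling c∈ c*∈ c*≢c (e ∷ w) len with redirect c*∈ c∈ e w
  ... | _ , e′ , w′ , eq = acyclic e′ w′ (subst (_< k) (sym eq) len)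

  -- The first arc can start at `c′` instead of `c`, which closes the walk.
  no-walk-to-twin : ∀ {c c′ e} → e ∈ N⁺ c → e ∈ N⁺ c′ → c′ ≢ c → (w : Walk c c′) → length w ≤ k → ⊥
  no-walk-to-twin e∈ e∈′ c′≢c []      _   = c′≢c refl
  no-walk-to-twin e∈ e∈′ c′≢c (f ∷ w) len = acyclic (share e∈ e∈′ f) w len

  -- The last alternative covers both `c′` and its sibling `c′*`: each is an out-neighbour of `p`.
  -- It remains to see that the three exceptions are distinct and unreached, so that with
  -- `reach k c` they exhaust all vertices.
  reached-unless-exceptional : ∀ {b c c*} → c ∈ N⁺ b → c* ∈ N⁺ b → c* ≢ c → ∀ y →
    (∃ λ (w : Walk c y) → length w ≤ k) ⊎ y ≡ c* ⊎
    (∃₂ λ c′ p → c′ ∈ N⁺ p × y ∈ N⁺ p × ∃ λ e → e ∈ N⁺ c × e ∈ N⁺ c′)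
  reached-unless-exceptional {b} {c} {c*} c∈b c*∈b c*≢c y
    with out c
  ... | e , e∈c with other-in e∈c
  ... | c′ , c′≢c , e∈c′ , _ with inn c′
  ... | p , c′∈p with other-out c′∈p
  ... | c′* , c′*≢c′ , c′*∈p = classify (unique-complete all! (≤-reflexive n≡) y)
    where
    siblings-not-twins : ∀ {q} → c ∈ N⁺ q → c′ ∈ N⁺ q → ⊥
    -- From `q` there would be two walks of length 2 to `e`.
    siblings-not-twins c∈q c′∈q = c′≢c (fork c′∈q c∈q (e∈c′ ∷ []) (e∈c ∷ []) 1<k 1<k)

    c*≢c′ : c* ≢ c′
    c*≢c′ refl = siblings-not-twins c∈b c*∈b

    c*≢c′* : c* ≢ c′*
    c*≢c′* refl = siblings-not-twins c∈b (share c′*∈p c*∈b c′∈p)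

    no-walk-to-c′* : (w : Walk c c′*) → length w ≤ k → ⊥
    -- A trivial walk means `c` is `c′*`, making `c` and `c′` siblings under `p`.
    no-walk-to-c′* []      _   = siblings-not-twins c′*∈p c′∈p
    no-walk-to-c′* (f ∷ w) len with redirect c′*∈p c′∈p f w
    ... | _ , f′ , w′ , eq =
      no-walk-to-twin e∈c e∈c′ c′≢c (f′ ∷ w′) (subst (_< k) (sym eq) len)

    unreached : ∀ {z} → ((w : Walk c z) → length w ≤ k → ⊥) → z ∉ˡ reach k c
    unreached no-walk z∈ = let w , len = reach⇒walk k z∈ in no-walk w len

    all! : Unique (c* ∷ c′ ∷ c′* ∷ reach k c)
    all! = ∉⇒∷-unique
      (λ { (here eq) → c*≢c′ eq
         ; (there (here eq)) → c*≢c′* eq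
         ; (there (there z∈)) → unreached (no-walk-to-sibling c∈b c*∈b c*≢c) z∈ })
      (∉⇒∷-unique
        (λ { (here eq) → c′*≢c′ (sym eq)
           ; (there z∈) → unreached (no-walk-to-twin e∈c e∈c′ c′≢c) z∈ })
        (∉⇒∷-unique (unreached no-walk-to-c′*) (reach! k c ≤-refl)))

    n≡ : n ≡ 3 + List.length (reach k c)
    n≡ = trans order (trans (+-comm (M 2 k) 3) (cong (3 +_) (sym (length-reach k c))))

    classify : y ∈ˡ c* ∷ c′ ∷ c′* ∷ reach k c → _
    classify (here refl)                 = inj₂ (inj₁ refl)
    classify (there (here refl))         = inj₂ (inj₂ (c′ , p , c′∈p , c′∈p , e , e∈c , e∈c′))
    classify (there (there (here refl))) = inj₂ (inj₂ (c′ , p , c′∈p , c′*∈p , e , e∈c , e∈c′))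
    classify (there (there (there y∈)))  = inj₁ (reach⇒walk k y∈)

  -- The strict bound leaves room to prepend the arc from `b₁` to `c`.
  walk-to-twin : ∀ {a b₁ b₂ b₂′ c c* d} → b₁ ∈ N⁺ a → b₂ ∈ N⁺ a → b₂ ≢ b₁ →
    c ∈ N⁺ b₁ → c* ∈ N⁺ b₁ → c* ≢ c → d ∈ N⁺ b₂ → (∀ {u} → d ∈ N⁺ u → u ≡ b₂ ⊎ u ≡ b₂′) →
    ∃ λ (w : Walk c b₂′) → length w < k
  walk-to-twin {d = d} b₁∈ b₂∈ b₂≢b₁ c∈ c*∈ c*≢c d∈ only
    with reached-unless-exceptional c∈ c*∈ c*≢c d
  ... | inj₂ (inj₁ refl) = contradiction (fork b₂∈ b₁∈ (d∈ ∷ []) (c*∈ ∷ []) 1<k 1<k) b₂≢b₁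
  -- Here `b₂` shares `d` with `p`, so `c′` is an out-neighbour of `b₂`. The walks from `a` to `e`
  -- through `b₂`, `c′` and through `b₁`, `c` have length 3, which calls for `3 ≤ k`.
  ... | inj₂ (inj₂ (c′ , p , c′∈p , d∈p , e , e∈c , e∈c′)) =
    contradiction (fork b₂∈ b₁∈ (share d∈p d∈ c′∈p ∷ e∈c′ ∷ []) (c∈ ∷ e∈c ∷ []) 3≤k 3≤k) b₂≢b₁
  ... | inj₁ ([] , _) = contradiction (fork b₂∈ b₁∈ (d∈ ∷ []) (c∈ ∷ []) 1<k 1<k) b₂≢b₁
  ... | inj₁ (f ∷ w , len) with unsnoc f w
  ...   | u , d∈u , w′ , eq with only d∈u
  ...     | inj₂ refl = w′ , subst (_< k) (sym eq) len
  ...     | inj₁ refl with redirect b₂∈ b₁∈ c∈ w′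
  ...       | _ , g , w″ , eq″ = contradiction (subst (_< k) (sym (trans eq″ eq)) len) (acyclic g w″)

  impossible : ⊥
  impossible with proj₁ (proj₂ minOutdegree)
  ... | a with out a
  ... | b₁ , b₁∈ with other-out b₁∈ | out b₁
  ... | b₂ , b₂≢b₁ , b₂∈ | c₁ , c₁∈ with other-out c₁∈ | out b₂
  ... | c₂ , c₂≢c₁ , c₂∈ | d , d∈ with other-in d∈
  ... | b₂′ , _ , _ , only
    -- The same `d` and `only` serve both calls, so both walks end at the same `b₂′`.
    with walk-to-twin b₁∈ b₂∈ b₂≢b₁ c₁∈ c₂∈ c₂≢c₁ d∈ only
       | walk-to-twin b₁∈ b₂∈ b₂≢b₁ c₂∈ c₁∈ (c₂≢c₁ ∘ sym) d∈ only
  ... | w₁ , <k₁ | w₂ , <k₂ = c₂≢c₁ (fork c₂∈ c₁∈ w₂ w₁ <k₂ <k₁)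

theorem2 : ∀ (k n : ℕ) (G : Digraph n) → 3 ≤ k →
    IsExcessDigraph 2 k 3 G → Digraph.Diregular G 2 →
    ∃₂ λ u v → u ≢ v × ∣ Digraph.N⁺ G u ∩ Digraph.N⁺ G v ∣ ≡ 1
theorem2 k n G 3≤k excess diregular
  -- The search is finite and decidable, so refuting the absence of a pair produces one
  -- constructively.
  with any? (λ u → any? (λ v → ¬? (u ≟ v) ×-dec (∣ Digraph.N⁺ G u ∩ Digraph.N⁺ G v ∣ ℕ.≟ 1)))
... | yes found = found
... | no  none  = ⊥-elim
  (NoSinglyShared.impossible G 3≤k excess diregular (λ u v u≢v eq → none (u , v , u≢v , eq)))
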